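{- Let $n\ge2$ and let $\mathbf A=(A,q,\mathsf e_1,\dots,\mathsf e_n)$ be an $n\mathrm{BA}$. (i) Every multideal of $\mathbf A$ can be extended to an ultramultideal: for every multideal $(I_1,\dots,I_n)$ of $\mathbf A$ there is an ultramultideal $(G_1,\dots,G_n)$ of $\mathbf A$ with $I_k\subseteq G_k$ for all $k$. (ii) There is a bijective correspondence between the ultramultideals of $\mathbf A$ and the homomorphisms from $\mathbf A$ onto $\mathbf n$.
   Context: Let $n\ge 2$. An $n\mathrm{BA}$ (Boolean-like algebra of dimension $n$) is an algebra $\mathbf A=(A,q,\mathsf e_1,\dots,\mathsf e_n)$ with $q$ of arity $n+1$ and constants $\mathsf e_1,\dots,\mathsf e_n$ satisfying the identities (B0) $q(\mathsf e_i,x^1,\dots,x^n)=x^i$ for $i=1,\dots,n$; (B1) $q(y,x,\dots,x)=x$; (B2) $q(y,q(y,x^{11},\dots,x^{1n}),\dots,q(y,x^{n1},\dots,x^{nn}))=q(y,x^{11},x^{22},\dots,x^{nn})$; (B3) $q(y,q(x^{10},\dots,x^{1n}),\dots,q(x^{n0},\dots,x^{nn}))=q(q(y,x^{10},\dots,x^{n0}),\dots,q(y,x^{1n},\dots,x^{nn}))$; (B4) $q(y,\mathsf e_1,\dots,\mathsf e_n)=y$. $\mathbf n$ is the $n\mathrm{BA}$ with the $n$-element universe $\{\mathsf e_1,\dots,\mathsf e_n\}$ and $q(\mathsf e_i,x^1,\dots,x^n)=x^i$. A multideal of $\mathbf A$ is a tuple $(I_1,\dots,I_n)$ of pairwise disjoint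 subsets of $A$ such that: (m1) $\mathsf e_k\in I_k$ for all $k$; (m2) if $a\in I_r$, $b\in I_k$ and $y_1,\dots,y_n\in A$, then $q(a,y_1,\dots,y_{r-1},b,y_{r+1},\dots,y_n)\in I_k$; (m3) if $a\in A$ and $y_1,\dots,y_n\in I_k$, then $q(a,y_1,\dots,y_n)\in I_k$. An ultramultideal is a multideal with $I_1\cup\dots\cup I_n=A$. -}

module Defs where

open import Level using (Level; _⊔_; suc)
open import Data.Nat.Base using (ℕ)
open import Data.Fin.Base using (Fin)
open import Data.Product.Base using (_,_; proj₁; proj₂)
open import Data.Vec.Functional using (Vector; updateAt)
open import Function.Base using (const; id)
open import Function.Definitions using (Congruent; Surjective)
open import Relation.Binary.Bundles using (Setoid)
open import Relation.Binary.Core using (Rel)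
open import Relation.Binary.Definitions using (_Respects_)
open import Relation.Binary.PropositionalEquality.Core using (_≡_; _≢_; refl)
open import Relation.Binary.PropositionalEquality.Properties using (isEquivalence)
open import Relation.Binary.Structures using (IsEquivalence)
open import Relation.Unary using (Pred; _∈_; _⊥_; _≐_; Universal; ⋃)

-- As for the algebraic structures of the standard library, equality in the
-- carrier is an arbitrary equivalence relation preserved by the operations.
-- The (n+1)-ary q takes its last n arguments as a vector; the indices
-- 1, …, n are represented by the elements of Fin n.
record NBA (n : ℕ) (c ℓ : Level) : Set (suc (c ⊔ ℓ)) where
  infix 4 _≈_
  field
    Carrier : Set c
    _≈_     : Rel Carrier ℓ
    q       : Carrier → Vector Carrier n → Carrier
    e       : Vector Carrier n

    ≈-isEquivalence : IsEquivalence _≈_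
    q-cong : ∀ {a b xs ys} → a ≈ b → (∀ i → xs i ≈ ys i) → q a xs ≈ q b ys

    B0 : ∀ i (x : Vector Carrier n) → q (e i) x ≈ x i
    B1 : ∀ y x → q y (λ _ → x) ≈ x
    B2 : ∀ y (x : Fin n → Fin n → Carrier) →
         q y (λ i → q y (λ j → x i j)) ≈ q y (λ i → x i i)
    -- x⁰ i stands for x^{i0}, and x i j for x^{ij} with j ≥ 1.
    B3 : ∀ y (x⁰ : Vector Carrier n) (x : Fin n → Fin n → Carrier) →
         q y (λ i → q (x⁰ i) (λ j → x i j)) ≈
         q (q y (λ i → x⁰ i)) (λ j → q y (λ i → x i j))
    B4 : ∀ y → q y e ≈ y

𝐧 : ∀ n → NBA n Level.zero Level.zero
𝐧 n = record
  { Carrier         = Fin n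
  ; _≈_             = _≡_
  ; q               = λ i x → x i
  ; e               = id
  ; ≈-isEquivalence = isEquivalence
  ; q-cong          = λ { {a = a} refl xs≈ys → xs≈ys a }
  ; B0              = λ _ _ → refl
  ; B1              = λ _ _ → refl
  ; B2              = λ _ _ → refl
  ; B3              = λ _ _ _ → refl
  ; B4              = λ _ → refl
  }

module _ {n : ℕ} {c ℓ : Level} (A : NBA n c ℓ) where
  open NBA A

  record IsMultideal {p} (I : Fin n → Pred Carrier p) : Set (c ⊔ ℓ ⊔ p) where
    field
      -- I k is a subset of the setoid A, not merely of its underlying type.
      resp     : ∀ k → I k Respects _≈_
      disjoint : ∀ {j k} → j ≢ k → I j ⊥ I k
      m1       : ∀ k → e k ∈ I k
      m2       : ∀ {r k a b} → a ∈ I r → b ∈ I k → (y : Vector Carrier n) →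
                 q a (updateAt y r (const b)) ∈ I k
      m3       : ∀ {k} a {y : Vector Carrier n} → (∀ i → y i ∈ I k) →
                 q a y ∈ I k

  record IsUltramultideal {p} (I : Fin n → Pred Carrier p) : Set (c ⊔ ℓ ⊔ p) where
    field
      isMultideal : IsMultideal I
      covers      : Universal (⋃ (Fin n) I)

    open IsMultideal isMultideal public

  record Ultramultideal (p : Level) : Set (c ⊔ ℓ ⊔ suc p) where
    field
      sets             : Fin n → Pred Carrier p
      isUltramultideal : IsUltramultideal sets

    open IsUltramultideal isUltramultideal public

  -- Two ultramultideals are equal when they have the same elements.
  ultramultidealSetoid : (p : Level) → Setoid (c ⊔ ℓ ⊔ suc p) (c ⊔ p)
  ultramultidealSetoid p = record
    { Carrier       = Ultramultideal p
    ; _≈_           = λ G H → ∀ k → sets G k ≐ sets H k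
    ; isEquivalence = record
      { refl  = λ _ → id , id
      ; sym   = λ G≐H k → proj₂ (G≐H k) , proj₁ (G≐H k)
      ; trans = λ G≐H H≐K k →
          (λ x∈G → proj₁ (H≐K k) (proj₁ (G≐H k) x∈G)) ,
          (λ x∈K → proj₂ (G≐H k) (proj₂ (H≐K k) x∈K))
      }
    }
    where open Ultramultideal

module _ {n : ℕ} {c₁ ℓ₁ c₂ ℓ₂ : Level} (A : NBA n c₁ ℓ₁) (B : NBA n c₂ ℓ₂) where
  private
    module A = NBA A
    module B = NBA B

  record IsHomomorphism (f : A.Carrier → B.Carrier) : Set (c₁ ⊔ ℓ₁ ⊔ ℓ₂) where
    field
      cong   : Congruent A._≈_ B._≈_ f
      q-homo : ∀ a (x : Vector A.Carrier n) →
               f (A.q a x) B.≈ B.q (f a) (λ i → f (x i))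
      e-homo : ∀ i → f (A.e i) B.≈ B.e i

  record OntoHomomorphism : Set (c₁ ⊔ ℓ₁ ⊔ c₂ ⊔ ℓ₂) where
    field
      map            : A.Carrier → B.Carrier
      isHomomorphism : IsHomomorphism map
      onto           : Surjective A._≈_ B._≈_ map

    open IsHomomorphism isHomomorphism public

  -- Two homomorphisms are equal when they agree at every point.
  ontoHomomorphismSetoid : Setoid (c₁ ⊔ ℓ₁ ⊔ c₂ ⊔ ℓ₂) (c₁ ⊔ ℓ₂)
  ontoHomomorphismSetoid = record
    { Carrier       = OntoHomomorphism
    ; _≈_           = λ f g → ∀ a → map f a B.≈ map g a
    ; isEquivalence = record
      { refl  = λ _ → B≈.refl
      ; sym   = λ f≈g a → B≈.sym (f≈g a)
      ; trans = λ f≈g g≈h a → B≈.trans (f≈g a) (g≈h a)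
      }
    }
    where
    open OntoHomomorphism
    module B≈ = IsEquivalence B.≈-isEquivalence

{-# OPTIONS --safe #-}

-- (i) By Zorn's lemma it suffices that a maximal multideal G is ultra.
-- Identifying a with e_k turns G_j into {x : q(a,e_j,…,x,…,e_j) ∈ G_j}, x in
-- place k; this family satisfies every multideal axiom except perhaps
-- disjointness, and a lies in its k-th member.  A family without disjointness
-- in which two members overlap is constantly A by (B2) and (m3).  If that
-- happened for every k, (B2) and (m3) applied to q(a,-,…,-) would show that G
-- itself is constantly A.  So some k gives a multideal, which is G by
-- maximality, and a ∈ G_k.
--
-- (ii) An ultramultideal G corresponds to the map sending G_k to k, and a
-- homomorphism to the family of its fibres.
module Submission where

open import Level using (Level; _⊔_; 0ℓ; Lift; lift; lower)
open import Axiom.ExcludedMiddle using (ExcludedMiddle)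
open import Axiom.Extensionality.Propositional using (Extensionality)
open import Data.Bool.Base using (Bool; true; false; T)
open import Data.Empty using (⊥-elim)
open import Data.Fin.Base using (Fin; zero; suc)
open import Data.Fin.Properties using (_≟_)
open import Data.Nat.Base using (ℕ; _≤_; z≤n; s≤s)
open import Data.Product.Base using (_×_; _,_; ∃; ∃-syntax; proj₁; proj₂)
open import Data.Sum.Base as Sum using (_⊎_; inj₁; inj₂)
open import Data.Unit.Base using (tt)
open import Data.Vec.Functional using (Vector)
open import Data.Vec.Functional.Properties using (updateAt-updates; updateAt-id-local)
open import Function.Base using (const; id; _∘_)
open import Function.Bundles using (Bijection)
open import Relation.Binary.Definitions using (_Respects_)
open import Relation.Binary.PropositionalEquality.Core
  using (_≡_; _≢_; refl; sym; trans; subst)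
open import Relation.Binary.Structures using (IsEquivalence)
open import Relation.Nullary.Decidable
  using (Dec; yes; no; map′; ⌊_⌋; toWitness; fromWitness; decidable-stable)
open import Relation.Nullary.Negation using (¬_)
open import Relation.Unary using (Pred; _∈_; _⊆_; _⊥_)
open import Defs

-- Boolean-valued subsets and chains.

lowerExcludedMiddle : ∀ a b → ExcludedMiddle (a ⊔ b) → ExcludedMiddle a
lowerExcludedMiddle a b em {P} = map′ lower lift (em {Lift b P})

T-injective : ∀ {x y} → (T x → T y) → (T y → T x) → x ≡ y
T-injective {false} {false} f g = refl
T-injective {false} {true}  f g = ⊥-elim (g tt)
T-injective {true}  {false} f g = ⊥-elim (f tt)
T-injective {true}  {true}  f g = refl

-- Subsets are Boolean-valued, so that by extensionality mutually included
-- ones are equal.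
Subset : ∀ {a} → Set a → Set a
Subset S = S → Bool

infix 4 _⊑_
_⊑_ : ∀ {a} {S : Set a} → Subset S → Subset S → Set a
X ⊑ Y = ∀ s → T (X s) → T (Y s)

IsChain : ∀ {a} {S : Set a} → Subset (Subset S) → Set a
IsChain F = ∀ U V → T (F U) → T (F V) → U ⊑ V ⊎ V ⊑ U

-- Lets (m3) pass to the union of a chain: its `n` premises may come from different members, and the
-- largest of these satisfies all of them. For the empty vector any member of `F` serves.
chain-bound : ∀ {a} {S : Set a} (F : Subset (Subset S)) → IsChain F → ∃ (T ∘ F) →
              ∀ {m} (s : Vector S m) → (∀ i → ∃[ U ] T (F U) × T (U (s i))) →
              ∃[ U ] T (F U) × (∀ i → T (U (s i)))
chain-bound F chain (U , U∈F) {ℕ.zero} s s∈⋃F = U , U∈F , λ ()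
chain-bound F chain F≢∅ {ℕ.suc m} s s∈⋃F
  with s∈⋃F zero | chain-bound F chain F≢∅ (s ∘ suc) (s∈⋃F ∘ suc)
... | U , U∈F , s₀∈U | V , V∈F , s₊∈V with chain U V U∈F V∈F
... | inj₁ U⊑V = V , V∈F , λ { zero → U⊑V _ s₀∈U ; (suc i) → s₊∈V i }
... | inj₂ V⊑U = U , U∈F , λ { zero → s₀∈U ; (suc i) → V⊑U _ (s₊∈V i) }

-- Zorn's lemma.

module Zorn {a i} (em : ExcludedMiddle (a ⊔ i)) (ext : Extensionality a 0ℓ)
            {S : Set a} (Good : Subset S → Set i) where

  private
    em-a : ExcludedMiddle a
    em-a = lowerExcludedMiddle a i em

  ⊑-antisym : ∀ {X Y : Subset S} → X ⊑ Y → Y ⊑ X → X ≡ Y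
  ⊑-antisym X⊑Y Y⊑X = ext λ s → T-injective (X⊑Y s) (Y⊑X s)

  ⋃ : Subset (Subset S) → Subset S
  ⋃ F s = ⌊ em-a {∃[ U ] T (F U) × T (U s)} ⌋

  ⋃-elim : ∀ F s → T (⋃ F s) → ∃[ U ] T (F U) × T (U s)
  ⋃-elim F s = toWitness

  ⋃-upper : ∀ F U → T (F U) → U ⊑ ⋃ F
  ⋃-upper F U U∈F s s∈U = fromWitness (U , U∈F , s∈U)

  ⋃-least : ∀ F X → (∀ U → T (F U) → U ⊑ X) → ⋃ F ⊑ X
  ⋃-least F X F⊑X s s∈⋃F with ⋃-elim F s s∈⋃F
  ... | U , U∈F , s∈U = F⊑X U U∈F s s∈U

  ProperGood : Subset S → Set (a ⊔ i)
  ProperGood X = ∃[ Y ] Good Y × X ⊑ Y × ¬ Y ⊑ X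

  -- The choice function of Zorn's lemma: a positive decision of `ProperGood X` carries a strictly
  -- larger good set.
  enlargeBy : ∀ X → Dec (ProperGood X) → Subset S
  enlargeBy X (yes (Y , _)) = Y
  enlargeBy X (no _)        = X

  enlarge : Subset S → Subset S
  enlarge X = enlargeBy X em

  enlarge-extensive : ∀ X → X ⊑ enlarge X
  enlarge-extensive X with em {ProperGood X}
  ... | yes (_ , _ , X⊑Y , _) = X⊑Y
  ... | no _                  = λ _ → id

  enlarge-good : ∀ X → Good X → Good (enlarge X)
  enlarge-good X good with em {ProperGood X}
  ... | yes (_ , good′ , _) = good′
  ... | no _                = good

  enlarge-fixed⇒maximal : ∀ X → enlarge X ⊑ X → ∀ Y → Good Y → X ⊑ Y → Y ⊑ X
  enlarge-fixed⇒maximal X fixed Y good X⊑Y with em {ProperGood X}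
  ... | yes (_ , _ , _ , Z⋢X) = ⊥-elim (Z⋢X fixed)
  ... | no maximal = decidable-stable em-a λ Y⋢X → maximal (Y , good , X⊑Y , Y⋢X)

  -- Any two members of the tower over X₀ are comparable, and the union of the
  -- whole tower belongs to it, so enlarge fixes that union.
  module _ (X₀ : Subset S) where

    -- Since `F` is Boolean-valued, `union` ranges over all subfamilies without raising the level.
    -- Nonemptiness of `F` keeps `X₀` below every union.
    data Tower : Subset S → Set a where
      base  : Tower X₀
      step  : ∀ {X} → Tower X → Tower (enlarge X)
      union : ∀ F → ∃ (T ∘ F) → (∀ U → T (F U) → Tower U) → Tower (⋃ F)

    base-least : ∀ {X} → Tower X → X₀ ⊑ X
    base-least base s = id
    base-least (step {X} t) s = enlarge-extensive X s ∘ base-least t s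
    base-least (union F (U , U∈F) t) s = ⋃-upper F U U∈F s ∘ base-least (t U U∈F) s

    Above : Subset S → Set a
    Above X = ∀ {Y} → Tower Y → X ⊑ Y ⊎ enlarge Y ⊑ X

    -- Induction on the tower of `Y`: a step that starts inside `X` and does not stay there must
    -- start at `X` itself.
    no-gap : ∀ {X} → Tower X → Above X → ∀ {Y} → Tower Y → enlarge X ⊑ Y ⊎ Y ⊑ X
    no-gap tX above base = inj₂ (base-least tX)
    no-gap {X} tX above (step {Y} tY) with above tY
    ... | inj₂ eY⊑X = inj₂ eY⊑X
    ... | inj₁ X⊑Y with no-gap tX above tY
    ...   | inj₁ eX⊑Y = inj₁ λ s → enlarge-extensive Y s ∘ eX⊑Y s
    -- `enlarge` need not be monotone, so mutual inclusion is first turned into equality.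
    ...   | inj₂ Y⊑X  = inj₁ (subst (λ Z → enlarge X ⊑ enlarge Z) (⊑-antisym X⊑Y Y⊑X) (λ _ → id))
    no-gap {X} tX above (union F _ t)
      with em-a {∃[ U ] T (F U) × enlarge X ⊑ U}
    ... | yes (U , U∈F , eX⊑U) = inj₁ λ s → ⋃-upper F U U∈F s ∘ eX⊑U s
    ... | no none = inj₂ (⋃-least F X λ U U∈F →
            Sum.[ (λ eX⊑U → ⊥-elim (none (U , U∈F , eX⊑U))) , id ] (no-gap tX above (t U U∈F)))

    tower-above : ∀ {X} → Tower X → Above X
    tower-above base tY = inj₁ (base-least tY)
    tower-above (step {X} tX) {Y} tY with tower-above tX tY
    ... | inj₂ eY⊑X = inj₂ λ s → enlarge-extensive X s ∘ eY⊑X s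
    ... | inj₁ X⊑Y with no-gap tX (tower-above tX) tY
    ...   | inj₁ eX⊑Y = inj₁ eX⊑Y
    ...   | inj₂ Y⊑X  = inj₂ (subst (λ Z → enlarge Z ⊑ enlarge X) (⊑-antisym X⊑Y Y⊑X) (λ _ → id))
    tower-above (union F _ t) {Y} tY
      with em-a {∃[ U ] T (F U) × enlarge Y ⊑ U}
    ... | yes (U , U∈F , eY⊑U) = inj₂ λ s → ⋃-upper F U U∈F s ∘ eY⊑U s
    ... | no none = inj₁ (⋃-least F Y λ U U∈F →
            Sum.[ id , (λ eY⊑U → ⊥-elim (none (U , U∈F , eY⊑U))) ] (tower-above (t U U∈F) tY))

    tower-chain : ∀ F → (∀ U → T (F U) → Tower U) → IsChain F
    tower-chain F t U V U∈F V∈F =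
      Sum.map₂ (λ eV⊑U s → eV⊑U s ∘ enlarge-extensive V s) (tower-above (t U U∈F) (t V V∈F))

    module _ (good₀ : Good X₀)
             (⋃-good : ∀ F → IsChain F → ∃ (T ∘ F) → (∀ U → T (F U) → Good U) → Good (⋃ F))
             where

      tower-good : ∀ {X} → Tower X → Good X
      tower-good base = good₀
      tower-good (step {X} t) = enlarge-good X (tower-good t)
      tower-good (union F F≢∅ t) =
        ⋃-good F (tower-chain F t) F≢∅ λ U U∈F → tower-good (t U U∈F)

      zorn : ∃[ M ] Good M × X₀ ⊑ M × (∀ Y → Good Y → M ⊑ Y → Y ⊑ M)
      zorn = ⋃ F , tower-good top , base-least top ,
             enlarge-fixed⇒maximal (⋃ F) (⋃-upper F _ (fromWitness (step top)))
        where
        F : Subset (Subset S)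
        F X = ⌊ em-a {Tower X} ⌋
        top : Tower (⋃ F)
        top = union F (X₀ , fromWitness base) λ _ → toWitness

-- Premultideals and the adjunction of an element.

module Multideals {n c ℓ} (A : NBA n c ℓ) where
  open NBA A
  private module ≈ = IsEquivalence ≈-isEquivalence

  -- The axioms of a multideal except disjointness, with (m2) stated for a
  -- vector v whose r-th entry is b.
  record IsPremultideal {p} (I : Fin n → Pred Carrier p) : Set (c ⊔ ℓ ⊔ p) where
    field
      resp : ∀ k → I k Respects _≈_
      m1   : ∀ k → e k ∈ I k
      m2   : ∀ {r k a} (v : Vector Carrier n) → a ∈ I r → v r ∈ I k → q a v ∈ I k
      m3   : ∀ {k} a {y : Vector Carrier n} → (∀ i → y i ∈ I k) → q a y ∈ I k

  toPremultideal : ∀ {p} {I : Fin n → Pred Carrier p} → IsMultideal A I → IsPremultideal I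
  toPremultideal {I = I} isMultideal = record
    { resp = resp
    ; m1   = m1
    ; m2   = λ {r} {k} v a∈I vr∈I →
        resp k (q-cong ≈.refl λ i → ≈.reflexive (updateAt-id-local r v refl i))
               (m2 a∈I vr∈I v)
    ; m3   = m3
    }
    where open IsMultideal isMultideal

  fromPremultideal : ∀ {p} {I : Fin n → Pred Carrier p} → IsPremultideal I →
                     (∀ {j k} → j ≢ k → I j ⊥ I k) → IsMultideal A I
  fromPremultideal {I = I} isPre disjoint = record
    { resp     = resp
    ; disjoint = disjoint
    ; m1       = m1
    ; m2       = λ {r} {k} a∈I b∈I y →
        m2 _ a∈I (subst (I k) (sym (updateAt-updates r y)) b∈I)
    ; m3       = m3
    }
    where open IsPremultideal isPre

  place : Fin n → Carrier → Carrier → Vector Carrier n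
  place k x y i with i ≟ k
  ... | yes _ = x
  ... | no  _ = y

  place-here : ∀ k x y → place k x y k ≡ x
  place-here k x y with k ≟ k
  ... | yes _  = refl
  ... | no k≢k = ⊥-elim (k≢k refl)

  place-there : ∀ {i k} x y → i ≢ k → place k x y i ≡ y
  place-there {i} {k} x y i≢k with i ≟ k
  ... | yes i≡k = ⊥-elim (i≢k i≡k)
  ... | no _    = refl

  -- (B2) sees only the diagonal, which is constantly `w`. Hence, by (m3), `w` lies in a member as
  -- soon as every row does.
  q-place-diagonal : ∀ a w z → q a (λ m → q a (place m w z)) ≈ w
  q-place-diagonal a w z = ≈.trans (B2 a λ m → place m w z)
    (≈.trans (q-cong ≈.refl λ m → ≈.reflexive (place-here m w z)) (B1 a w))

  -- Row `m` has `e l` everywhere except at `m`. As `x` lies in two members, (m2) may be applied at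
  -- `i` or at `j`, and one of them differs from `m`.
  overlap⇒total : ∀ {p} {I : Fin n → Pred Carrier p} → IsPremultideal I →
                  ∀ {i j x} → i ≢ j → x ∈ I i → x ∈ I j → ∀ l w → w ∈ I l
  overlap⇒total {I = I} isPre {i} {j} {x} i≢j x∈Ii x∈Ij l w =
    resp l (q-place-diagonal x w (e l)) (m3 x entry)
    where
    open IsPremultideal isPre
    off-diagonal : ∀ {s m} → s ≢ m → place m w (e l) s ∈ I l
    off-diagonal s≢m = subst (I l) (sym (place-there w (e l) s≢m)) (m1 l)
    entry : ∀ m → q x (place m w (e l)) ∈ I l
    entry m with i ≟ m
    ... | no i≢m   = m2 _ x∈Ii (off-diagonal i≢m)
    ... | yes refl = m2 _ x∈Ij (off-diagonal (i≢j ∘ sym))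

  -- The premultideal obtained from I by identifying a with e k.
  adjoin : ∀ {p} → (Fin n → Pred Carrier p) → Carrier → Fin n → Fin n → Pred Carrier p
  adjoin I a k j x = q a (place k x (e j)) ∈ I j

  module _ {p} {I : Fin n → Pred Carrier p} (isPre : IsPremultideal I) (a : Carrier) where
    open IsPremultideal isPre

    ⊆-adjoin : ∀ k j → I j ⊆ adjoin I a k j
    ⊆-adjoin k j {x} x∈I = m3 a λ i → place-∈ i
      where
      place-∈ : ∀ i → place k x (e j) i ∈ I j
      place-∈ i with i ≟ k
      ... | yes _ = x∈I
      ... | no _  = m1 j

    -- (B4) and (B1) write every entry as `q a` of a row, and (B2) then leaves a diagonal that is
    -- constantly `e k`.
    ∈-adjoin : ∀ k → a ∈ adjoin I a k k
    ∈-adjoin k = resp k (≈.sym q≈eₖ) (m1 k)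
      where
      rows : ∀ i → place k a (e k) i ≈ q a (λ m → place k (e m) (e k) i)
      rows i with i ≟ k
      ... | yes _ = ≈.sym (B4 a)
      ... | no _  = ≈.sym (B1 a (e k))
      diagonal : ∀ i → place k (e i) (e k) i ≈ e k
      diagonal i with i ≟ k
      ... | yes refl = ≈.refl
      ... | no _     = ≈.refl
      q≈eₖ : q a (place k a (e k)) ≈ e k
      q≈eₖ = ≈.trans (q-cong ≈.refl rows)
            (≈.trans (B2 a λ i m → place k (e m) (e k) i)
            (≈.trans (q-cong ≈.refl diagonal) (B1 a (e k))))

    adjoin-isPremultideal : ∀ k → IsPremultideal (adjoin I a k)
    adjoin-isPremultideal k = record
      { resp = λ j x≈y → resp j (q-cong ≈.refl (place-cong x≈y))
      ; m1   = λ j → ⊆-adjoin k j (m1 j)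
      -- Filling `b̂` with `e r` off `k` makes `q a b̂` the very element that `b∈` puts in `I r`.
      ; m2   = λ {r} {j} {b} v b∈ vr∈ →
          resp j (≈.sym (q-place-q j v (place k b (e r)) (≈.reflexive (place-here k b (e r)))
                          λ i≢k → ≈.trans (q-cong (≈.reflexive (place-there b (e r) i≢k)) λ _ → ≈.refl)
                                          (B0 r _)))
                 (m2 _ b∈ vr∈)
      ; m3   = λ {j} b {y} y∈ →
          resp j (≈.sym (q-place-q j y (const b) ≈.refl λ _ → B1 b (e j))) (m3 _ y∈)
      }
      where
      place-cong : ∀ {x y z} → x ≈ y → ∀ i → place k x z i ≈ place k y z i
      place-cong x≈y i with i ≟ k
      ... | yes _ = x≈y
      ... | no _  = ≈.refl

      -- (B3) pulls the inner `q` out once the rows off `k` also have the form `q (b̂ i) _`; there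
      -- `b̂` may be anything that sends the constant row `e j` to `e j`.
      q-place-q : ∀ j v {b} (b̂ : Vector Carrier n) → b̂ k ≈ b →
                  (∀ {i} → i ≢ k → q (b̂ i) (const (e j)) ≈ e j) →
                  q a (place k (q b v) (e j)) ≈ q (q a b̂) (λ m → q a (place k (v m) (e j)))
      q-place-q j v {b} b̂ b̂ₖ≈b others =
        ≈.trans (q-cong ≈.refl rows) (B3 a b̂ λ i m → place k (v m) (e j) i)
        where
        rows : ∀ i → place k (q b v) (e j) i ≈ q (b̂ i) (λ m → place k (v m) (e j) i)
        rows i with i ≟ k
        ... | yes refl = q-cong (≈.sym b̂ₖ≈b) λ _ → ≈.refl
        ... | no i≢k   = ≈.sym (others i≢k)

    adjoin-all-total⇒total : (∀ k l w → w ∈ adjoin I a k l) → ∀ l w → w ∈ I l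
    adjoin-all-total⇒total total l w =
      resp l (q-place-diagonal a w (e l)) (m3 a λ k → total k l w)

  adjoin-isMultideal : ∀ {p} → ExcludedMiddle (c ⊔ p) →
    {I : Fin n → Pred Carrier p} → IsMultideal A I → ∀ {i j : Fin n} → i ≢ j →
    ∀ a → ∃[ k ] IsMultideal A (adjoin I a k)
  adjoin-isMultideal {p} em {I} isM {i₀} {j₀} i₀≢j₀ a
    with em {∃[ k ] ¬ Overlap k}
    where
    Overlap : Fin n → Set (c ⊔ p)
    Overlap k = ∃[ i ] ∃[ j ] ∃[ x ] i ≢ j × x ∈ adjoin I a k i × x ∈ adjoin I a k j
  ... | yes (k , ¬overlap) =
    k , fromPremultideal (adjoin-isPremultideal (toPremultideal isM) a k)
          λ i≢j {x} (x∈i , x∈j) → ¬overlap (_ , _ , x , i≢j , x∈i , x∈j)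
  ... | no ¬k =
    -- If every adjunction overlaps, `I` is total, so `e i₀` lies in two distinct members.
    ⊥-elim (IsMultideal.disjoint isM i₀≢j₀ (everything i₀ (e i₀) , everything j₀ (e i₀)))
    where
    isPre : IsPremultideal I
    isPre = toPremultideal isM
    everything : ∀ l w → w ∈ I l
    everything = adjoin-all-total⇒total isPre a λ k →
      let i , j , x , i≢j , x∈i , x∈j = decidable-stable em λ ¬overlap → ¬k (k , ¬overlap)
      in overlap⇒total (adjoin-isPremultideal isPre a k) i≢j x∈i x∈j

  -- Existence of ultramultideals.

  module _ {p} (em : ExcludedMiddle (c ⊔ ℓ ⊔ p)) (ext : Extensionality c 0ℓ) where

    -- A family is coded as one subset of a product, so that inclusion of subsets is memberwise
    -- inclusion of families.
    members : Subset (Carrier × Fin n) → Fin n → Pred Carrier p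
    members X k x = Lift p (T (X (x , k)))

    open Zorn {i = c ⊔ ℓ ⊔ p} em ext (λ X → IsMultideal A (members X))

    ⋃-isMultideal : ∀ F → IsChain F → ∃ (T ∘ F) →
                    (∀ U → T (F U) → IsMultideal A (members U)) → IsMultideal A (members (⋃ F))
    ⋃-isMultideal F chain (U₀ , U₀∈F) isM = fromPremultideal
      (record
        { resp = λ k x≈y x∈ → within x∈ λ U U∈F x∈U →
            into U∈F (IsMultideal.resp (isM U U∈F) k x≈y x∈U)
        ; m1   = λ k → into U₀∈F (IsMultideal.m1 (isM U₀ U₀∈F) k)
        ; m2   = λ v a∈ b∈ → within₂ a∈ b∈ λ U U∈F a∈U b∈U →
            into U∈F (IsPremultideal.m2 (toPremultideal (isM U U∈F)) v a∈U b∈U)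
        ; m3   = λ {k} a {y} y∈ →
            let U , U∈F , y∈U = chain-bound F chain (U₀ , U₀∈F) (λ i → y i , k)
                                  (λ i → ⋃-elim F _ (lower (y∈ i)))
            in into U∈F (IsMultideal.m3 (isM U U∈F) a λ i → lift (y∈U i))
        })
      λ j≢k {x} (x∈j , x∈k) → within₂ x∈j x∈k λ U U∈F x∈Uj x∈Uk →
        IsMultideal.disjoint (isM U U∈F) j≢k {x} (x∈Uj , x∈Uk)
      where
      into : ∀ {U k x} → T (F U) → x ∈ members U k → x ∈ members (⋃ F) k
      into {U} U∈F (lift x∈U) = lift (⋃-upper F U U∈F _ x∈U)

      within : ∀ {r} {R : Set r} {k x} → x ∈ members (⋃ F) k →
               (∀ U → T (F U) → x ∈ members U k → R) → R
      within (lift x∈) f with ⋃-elim F _ x∈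
      ... | U , U∈F , x∈U = f U U∈F (lift x∈U)

      within₂ : ∀ {r} {R : Set r} {j k x y} → x ∈ members (⋃ F) j → y ∈ members (⋃ F) k →
                (∀ U → T (F U) → x ∈ members U j → y ∈ members U k → R) → R
      within₂ x∈ y∈ f = within x∈ λ U U∈F (lift x∈U) → within y∈ λ V V∈F (lift y∈V) →
        Sum.[ (λ U⊑V → f V V∈F (lift (U⊑V _ x∈U)) (lift y∈V))
            , (λ V⊑U → f U U∈F (lift x∈U) (lift (V⊑U _ y∈V))) ] (chain U V U∈F V∈F)

    extend-to-ultramultideal : ∀ {i j : Fin n} → i ≢ j → (I : Fin n → Pred Carrier p) →
      IsMultideal A I → ∃[ G ] IsUltramultideal A {p} G × (∀ k → I k ⊆ G k)
    extend-to-ultramultideal i≢j I isM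
      with zorn X₀ good₀ ⋃-isMultideal
      where
      em-p : ExcludedMiddle p
      em-p = lowerExcludedMiddle p (c ⊔ ℓ) em
      X₀ : Subset (Carrier × Fin n)
      X₀ (x , k) = ⌊ em-p {I k x} ⌋
      good₀ : IsMultideal A (members X₀)
      good₀ = fromPremultideal
        (record
          { resp = λ k x≈y x∈ → enter (resp k x≈y (leave x∈))
          ; m1   = λ k → enter (m1 k)
          ; m2   = λ v a∈ b∈ →
              enter (IsPremultideal.m2 (toPremultideal isM) v (leave a∈) (leave b∈))
          ; m3   = λ a y∈ → enter (m3 a λ i → leave (y∈ i))
          })
        λ j≢k (x∈j , x∈k) → disjoint j≢k (leave x∈j , leave x∈k)
        where
        open IsMultideal isM
        enter : ∀ {k x} → x ∈ I k → x ∈ members X₀ k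
        enter x∈I = lift (fromWitness x∈I)
        leave : ∀ {k x} → x ∈ members X₀ k → x ∈ I k
        leave (lift x∈) = toWitness x∈
    ... | M , good , X₀⊑M , maximal =
      members M , record { isMultideal = good ; covers = covers } ,
      λ k x∈I → lift (X₀⊑M _ (fromWitness x∈I))
      where
      covers : ∀ a → ∃[ k ] a ∈ members M k
      covers a =
        let k , adj = adjoin-isMultideal (lowerExcludedMiddle (c ⊔ p) ℓ em) good i≢j a
            isPre   = toPremultideal good
            -- The Boolean form of the adjunction: `members M′` unfolds to `adjoin (members M) a k`.
            M′      = λ (x , j) → M (q a (place k x (e j)) , j)
        in k , lift (maximal M′ adj (λ (x , j) x∈M → lower (⊆-adjoin isPre a k j (lift x∈M)))
                             (a , k) (lower (∈-adjoin isPre a k)))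

-- Ultramultideals and homomorphisms onto `𝐧 n`.

module Correspondence {n c ℓ} (A : NBA n c ℓ) (p : Level) where
  open NBA A
  open Multideals A
  private module ≈ = IsEquivalence ≈-isEquivalence

  module _ (G : Ultramultideal A p) where
    open Ultramultideal G

    index : Carrier → Fin n
    index a = proj₁ (covers a)

    ∈-index : ∀ a → a ∈ sets (index a)
    ∈-index a = proj₂ (covers a)

    index-unique : ∀ {a k} → a ∈ sets k → index a ≡ k
    index-unique {a} {k} a∈ =
      decidable-stable (index a ≟ k) λ i≢k → disjoint i≢k (∈-index a , a∈)

    toHomomorphism : OntoHomomorphism A (𝐧 n)
    toHomomorphism = record
      { map            = index
      ; isHomomorphism = record
        { cong   = λ {a} {b} a≈b → index-unique (resp _ (≈.sym a≈b) (∈-index b))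
        -- In `𝐧 n` the operation selects the entry at `index a`; (m2) at that place puts `q a x` in
        -- the same member as that entry of `x`.
        ; q-homo = λ a x → index-unique
            (IsPremultideal.m2 (toPremultideal isMultideal) x (∈-index a) (∈-index (x (index a))))
        ; e-homo = λ i → index-unique (m1 i)
        }
      ; onto = λ i → e i , λ z≈eᵢ → index-unique (resp i (≈.sym z≈eᵢ) (m1 i))
      }

  fromHomomorphism : OntoHomomorphism A (𝐧 n) → Ultramultideal A p
  fromHomomorphism h = record
    { sets = λ k x → Lift p (map x ≡ k)
    ; isUltramultideal = record
      { isMultideal = fromPremultideal
          (record
            { resp = λ k x≈y (lift hx≡k) → lift (trans (sym (cong x≈y)) hx≡k)
            ; m1   = λ k → lift (e-homo k)
            ; m2   = λ { v (lift refl) (lift hv≡k) → lift (trans (q-homo _ v) hv≡k) }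
            ; m3   = λ a y∈ → lift (trans (q-homo a _) (lower (y∈ (map a))))
            })
          λ j≢k (lift hx≡j , lift hx≡k) → j≢k (trans (sym hx≡j) hx≡k)
      ; covers = λ a → map a , lift refl
      }
    }
    where open OntoHomomorphism h

  bijection : Bijection (ultramultidealSetoid A p) (ontoHomomorphismSetoid A (𝐧 n))
  bijection = record
    { to        = toHomomorphism
    ; cong      = λ {G} {H} G≐H a →
        sym (index-unique H (proj₁ (G≐H _) (∈-index G a)))
    ; bijective =
        (λ {G} {H} agree k →
            sameIndex G H agree , sameIndex H G (sym ∘ agree))
      -- For any `G` equal to the family of fibres of `h`, `a` lies in the fibre over `index G a`.
      , (λ h → fromHomomorphism h , λ {G} G≐h a →
            sym (lower (proj₁ (G≐h _) (∈-index G a))))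
    }
    where
    sameIndex : ∀ G H → (∀ a → index G a ≡ index H a) →
                ∀ {k} → Ultramultideal.sets G k ⊆ Ultramultideal.sets H k
    sameIndex G H agree {x = a} a∈G =
      subst (λ k → Ultramultideal.sets H k a)
            (trans (sym (agree a)) (index-unique G a∈G)) (∈-index H a)

theorem7p12 : ∀ {c ℓ p : Level} (n : ℕ) → 2 ≤ n → (A : NBA n c ℓ) →
    ( ExcludedMiddle (c ⊔ ℓ ⊔ p) → Extensionality c 0ℓ →
    (I : Fin n → Pred (NBA.Carrier A) p) → IsMultideal A I →
    ∃[ G ] (IsUltramultideal A {p} G × (∀ k → I k ⊆ G k)) )
    ×
    Bijection (ultramultidealSetoid A p) (ontoHomomorphismSetoid A (𝐧 n))
theorem7p12 {p = p} _ (s≤s (s≤s z≤n)) A =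
  (λ em ext → Multideals.extend-to-ultramultideal A em ext {zero} {suc zero} λ ()) ,
  Correspondence.bijection A p
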